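{- The system $\mathbf{NQGL}$ does not have the Craig interpolation property.
   Context: Language $\mathcal{L}$: countably many individual variables, Boolean constants $\top,\bot$, connectives $\neg,\to$, quantifier $\forall$, modal operator $\Box$, countably many predicate symbols of each arity (no function symbols, constants or equality). Formulas: $\top$, $\bot$, $P(u_1,\ldots,u_n)$, closed under $\neg$, $\to$, $\forall u$, $\Box$. $\Box^{k}A$ denotes $A$ prefixed by $k$ boxes. $\mathbf{QK}$: all instances of the axioms of classical first-order predicate logic, the axiom $\Box(A\to B)\to(\Box A\to\Box B)$, the rules of predicate logic (modus ponens, generalization) and necessitation $A/\Box A$. $\mathbf{QK4}$ is $\mathbf{QK}$ plus the axiom $\Box A\to\Box\Box A$. $\mathbf{NQGL}$ is obtained from $\mathbf{QK4}$ by adding the infinitary rule: if $\vdash\Box^{n+1}\bot\to A$ for all natural numbers $n$, then $\vdash A$. A logic $\mathbf{L}$ has the Craig interpolation property if for all $\mathcal{L}$-sentences $A,B$ with $\mathbf{L}\vdash A\to B$ there is an $\mathcal{L}$-sentence $C$ containing only predicate symbols occurring in both $A$ and $B$ with $\mathbf{L}\vdash A\to C$ and $\mathbf{L}\vdash C\to B$. -}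

module Defs where

open import Data.Nat using (ℕ; zero; suc; _≟_)
open import Data.Vec using (Vec; map)
open import Data.Vec.Membership.Propositional using (_∈_)
open import Data.Product using (Σ; _×_; ∃)
open import Data.Sum using (_⊎_)
open import Data.Unit using (⊤)
open import Relation.Nullary using (¬_; yes; no)
open import Relation.Binary.PropositionalEquality using (_≡_; _≢_)

Var : Set
Var = ℕ

record PredSym : Set where
  constructor psym
  field
    arity : ℕ
    index : ℕ

data Formula : Set where
  ⊤'   : Formula
  ⊥'   : Formula
  atom : (n i : ℕ) → Vec Var n → Formula
  ¬'_  : Formula → Formula
  _⇒_  : Formula → Formula → Formula
  ∀'   : Var → Formula → Formula
  □_   : Formula → Formula

infixr 5 _⇒_
infix 7 ¬'_ □_

□^ : ℕ → Formula → Formula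
□^ zero    A = A
□^ (suc k) A = □ (□^ k A)

data FreeIn (x : Var) : Formula → Set where
  atomᶠ : ∀ {n i} {us : Vec Var n} → x ∈ us → FreeIn x (atom n i us)
  negᶠ  : ∀ {A} → FreeIn x A → FreeIn x (¬' A)
  impˡᶠ : ∀ {A B} → FreeIn x A → FreeIn x (A ⇒ B)
  impʳᶠ : ∀ {A B} → FreeIn x B → FreeIn x (A ⇒ B)
  allᶠ  : ∀ {u A} → x ≢ u → FreeIn x A → FreeIn x (∀' u A)
  boxᶠ  : ∀ {A} → FreeIn x A → FreeIn x (□ A)

Sentence : Formula → Set
Sentence A = ∀ x → ¬ FreeIn x A

renameVar : Var → Var → Var → Var
renameVar y x z with z ≟ x
... | yes _ = y
... | no  _ = z

_[_/_] : Formula → Var → Var → Formula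
⊤'            [ y / x ] = ⊤'
⊥'            [ y / x ] = ⊥'
atom n i us   [ y / x ] = atom n i (map (renameVar y x) us)
(¬' A)        [ y / x ] = ¬' (A [ y / x ])
(A ⇒ B)       [ y / x ] = (A [ y / x ]) ⇒ (B [ y / x ])
∀' u A        [ y / x ] with u ≟ x
... | yes _ = ∀' u A
... | no  _ = ∀' u (A [ y / x ])
(□ A)         [ y / x ] = □ (A [ y / x ])

FreeFor : Var → Var → Formula → Set
FreeFor y x ⊤'            = ⊤
FreeFor y x ⊥'            = ⊤
FreeFor y x (atom n i us) = ⊤
FreeFor y x (¬' A)        = FreeFor y x A
FreeFor y x (A ⇒ B)       = FreeFor y x A × FreeFor y x B
FreeFor y x (∀' u A)      = ¬ FreeIn x (∀' u A) ⊎ (u ≢ y × FreeFor y x A)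
FreeFor y x (□ A)         = FreeFor y x A

-- The system NQGL = QK4 + the infinitary rule
--   from ⊢ □^{n+1}⊥ → A for all n, infer ⊢ A.
-- Classical first-order predicate logic is given by a standard Hilbert
-- calculus: propositional axiom schemes (Łukasiewicz) plus axioms for
-- ⊤, ⊥, the quantifier axiom schemes, modus ponens and generalization.

data NQGL⊢_ : Formula → Set where
  ax-K   : ∀ {A B}   → NQGL⊢ (A ⇒ (B ⇒ A))
  ax-S   : ∀ {A B C} → NQGL⊢ ((A ⇒ (B ⇒ C)) ⇒ ((A ⇒ B) ⇒ (A ⇒ C)))
  ax-Neg : ∀ {A B}   → NQGL⊢ ((¬' B ⇒ ¬' A) ⇒ (A ⇒ B))
  ax-⊤   : NQGL⊢ ⊤'
  ax-⊥   : NQGL⊢ (¬' ⊥')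
  ax-∀E  : ∀ {x y A} → FreeFor y x A → NQGL⊢ (∀' x A ⇒ (A [ y / x ]))
  ax-∀I  : ∀ {x A B} → ¬ FreeIn x A → NQGL⊢ (∀' x (A ⇒ B) ⇒ (A ⇒ ∀' x B))
  ax-□K  : ∀ {A B}   → NQGL⊢ (□ (A ⇒ B) ⇒ (□ A ⇒ □ B))
  ax-4   : ∀ {A}     → NQGL⊢ (□ A ⇒ □ □ A)
  mp     : ∀ {A B}   → NQGL⊢ (A ⇒ B) → NQGL⊢ A → NQGL⊢ B
  gen    : ∀ {x A}   → NQGL⊢ A → NQGL⊢ (∀' x A)
  nec    : ∀ {A}     → NQGL⊢ A → NQGL⊢ (□ A)
  ω-rule : ∀ {A}     → (∀ (n : ℕ) → NQGL⊢ (□^ (suc n) ⊥' ⇒ A)) → NQGL⊢ A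

infix 3 NQGL⊢_

data Occurs (P : PredSym) : Formula → Set where
  atomᵒ : ∀ {n i us} → P ≡ psym n i → Occurs P (atom n i us)
  negᵒ  : ∀ {A} → Occurs P A → Occurs P (¬' A)
  impˡᵒ : ∀ {A B} → Occurs P A → Occurs P (A ⇒ B)
  impʳᵒ : ∀ {A B} → Occurs P B → Occurs P (A ⇒ B)
  allᵒ  : ∀ {u A} → Occurs P A → Occurs P (∀' u A)
  boxᵒ  : ∀ {A} → Occurs P A → Occurs P (□ A)

CraigInterpolation : (Formula → Set) → Set
CraigInterpolation ⊢ =
  ∀ (A B : Formula) → Sentence A → Sentence B → ⊢ (A ⇒ B) →
  Σ Formula λ C →
    Sentence C ×
    (∀ P → Occurs P C → Occurs P A × Occurs P B) ×
    ⊢ (A ⇒ C) × ⊢ (C ⇒ B)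

{-# OPTIONS --safe #-}

-- Consider F(P)(x) = ∀ y (E x y → ◇ P y).  By induction on the depth of a
-- world, every P with P ⊆ F(P) is contained in every Q with F(Q) ⊆ Q, so the
-- ω-rule proves "F(Q) ⊆ Q and Q is not everything"  →
-- "if P ⊆ F(P) then P is not everything".
-- An interpolant mentions only E.  When E does not vary between worlds, a
-- sentence of modal depth d about E has the same truth value at all worlds of
-- depth ≥ d of the chain (ℕ, >).  But if E x y means y < x on {0, …, k}, then the
-- fixed point of F at depth w is {x | x ≤ w}, which becomes everything exactly
-- at depth k; taking k > d refutes the interpolant.
module Submission where

open import Defs
open import Data.Empty using (⊥; ⊥-elim)
open import Data.Fin using (Fin; zero; suc; toℕ; fromℕ; inject₁)
open import Data.Fin.Properties using (toℕ-fromℕ; toℕ-inject₁; toℕ≤pred[n])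
open import Data.List using (List; []; _∷_; _++_; filter; map)
open import Data.List.Membership.Propositional using (_∈_; _∉_)
open import Data.List.Membership.Propositional.Properties
  using (∈-filter⁺; ∈-map⁺; ∈-++⁺ˡ; ∈-++⁺ʳ)
open import Data.List.Relation.Unary.All using (All; []; _∷_; tabulate; lookup)
open import Data.List.Relation.Unary.Any using (here; there)
open import Data.Nat using (ℕ; zero; suc; _≟_; _≤_; _<_; _≤?_; _<?_; _⊔_; s≤s; z≤n)
open import Data.Nat.Properties
  using (≤-refl; ≤-trans; <-trans; n≤1+n; m⊔n≤o⇒m≤o; m⊔n≤o⇒n≤o;
         <-≤-trans; ≤-<-trans; ≤-total; 1+n≰n)
open import Data.Product using (_×_; _,_; proj₂)
open import Data.Sum using (inj₁; inj₂; [_,_]′)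
open import Data.Unit using (⊤; tt)
open import Data.Vec as Vec using (Vec; []; _∷_; toList)
open import Data.Vec.Membership.Propositional.Properties using (∈-toList⁺)
open import Data.Vec.Properties using (map-∘)
import Data.Vec.Membership.Propositional as Vec∈
import Data.Vec.Relation.Unary.Any as VecAny
open import Function using (_∘_; id)
open import Function.Bundles using (_⇔_; mk⇔; module Equivalence)
open import Relation.Binary.PropositionalEquality
  using (_≡_; _≢_; refl; sym; trans; cong; cong₂; subst)
open import Relation.Nullary using (¬_; ¬?; yes; no)
open import Relation.Nullary.Decidable using (decidable-stable)

open Equivalence using (to; from)

private variable
  A B : Formula
  Γ Δ : List Formula
  x y u : ℕ

-- Free variables as lists, so that freshness for concrete formulas is checked by computation.

freeVars : Formula → List Var
freeVars ⊤'            = []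
freeVars ⊥'            = []
freeVars (atom n i us) = toList us
freeVars (¬' A)        = freeVars A
freeVars (A ⇒ B)       = freeVars A ++ freeVars B
freeVars (∀' u A)      = filter (λ z → ¬? (z ≟ u)) (freeVars A)
freeVars (□ A)         = freeVars A

FreeIn⇒∈ : FreeIn x A → x ∈ freeVars A
FreeIn⇒∈ (atomᶠ x∈us)             = ∈-toList⁺ x∈us
FreeIn⇒∈ (negᶠ p)                 = FreeIn⇒∈ p
FreeIn⇒∈ (impˡᶠ p)                = ∈-++⁺ˡ (FreeIn⇒∈ p)
FreeIn⇒∈ (impʳᶠ {A = A} p)        = ∈-++⁺ʳ (freeVars A) (FreeIn⇒∈ p)
FreeIn⇒∈ (allᶠ {u = u} x≢u p)     = ∈-filter⁺ (λ z → ¬? (z ≟ u)) (FreeIn⇒∈ p) x≢u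
FreeIn⇒∈ (boxᶠ p)                 = FreeIn⇒∈ p

-- Derivations from hypotheses.

infix 3 _⊩_

-- Only modus ponens acts under hypotheses, so the deduction theorem needs no side conditions.
-- Generalization and necessitation under hypotheses are derived separately.
data _⊩_ (Γ : List Formula) : Formula → Set where
  hyp : A ∈ Γ → Γ ⊩ A
  thm : NQGL⊢ A → Γ ⊩ A
  app : Γ ⊩ A ⇒ B → Γ ⊩ A → Γ ⊩ B

pattern #0 = here refl
pattern #1 = there #0
pattern #2 = there #1
pattern #3 = there #2
pattern #4 = there #3

close : [] ⊩ A → NQGL⊢ A
close (thm p)   = p
close (app p q) = mp (close p) (close q)

cut : All (Γ ⊩_) Δ → Δ ⊩ A → Γ ⊩ A
cut σ (hyp i)   = lookup σ i
cut σ (thm p)   = thm p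
cut σ (app p q) = app (cut σ p) (cut σ q)

weaken : Γ ⊩ A → B ∷ Γ ⊩ A
weaken = cut (tabulate (hyp ∘ there))

deduction : A ∷ Γ ⊩ B → Γ ⊩ A ⇒ B
deduction {A = A} (hyp #0) = app (app (thm ax-S) (thm ax-K)) (thm (ax-K {B = A}))
deduction (hyp (there i))  = app (thm ax-K) (hyp i)
deduction (thm p)          = app (thm ax-K) (thm p)
deduction (app p q)        = app (app (thm ax-S) (deduction p)) (deduction q)

undischarge : Γ ⊩ A ⇒ B → A ∷ Γ ⊩ B
undischarge p = app (weaken p) (hyp #0)

-- Hypotheses are discharged one at a time until `gen` applies; `ax-∀I` then carries the quantifier
-- back past each of them.
generalize : All (λ B → x ∉ freeVars B) Γ → Γ ⊩ A → Γ ⊩ ∀' x A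
generalize []         p = thm (gen (close p))
generalize (x∉ ∷ x∉s) p =
  undischarge (app (thm (ax-∀I (x∉ ∘ FreeIn⇒∈))) (generalize x∉s (deduction p)))

necessitate : Γ ⊩ A → map □_ Γ ⊩ □ A
necessitate (hyp i)   = hyp (∈-map⁺ □_ i)
necessitate (thm p)   = thm (nec p)
necessitate (app p q) = app (app (thm ax-□K) (necessitate p)) (necessitate q)

instantiate : ∀ x y A → FreeFor y x A → Γ ⊩ ∀' x A → Γ ⊩ A [ y / x ]
instantiate x y A ff = app (thm (ax-∀E ff))

ex-falso : Γ ⊩ ⊥' → Γ ⊩ A
ex-falso = app (app (thm ax-Neg) (app (thm ax-K) (thm ax-⊥)))

double-negation-elim : Γ ⊩ ¬' ¬' A → Γ ⊩ A
double-negation-elim {A = A} p =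
  -- `ax-Neg`, applied twice to `¬' ¬' ¬' ¬' A ⇒ ¬' ¬' A`, turns it into `¬' ¬' A ⇒ A`.
  app (app (thm ax-Neg) (app (thm ax-Neg) (app (thm (ax-K {B = ¬' ¬' ¬' ¬' A})) p))) p

double-negation-intro : Γ ⊩ A → Γ ⊩ ¬' ¬' A
double-negation-intro = app (app (thm ax-Neg) (deduction (double-negation-elim (hyp #0))))

contrapose : Γ ⊩ A ⇒ B → Γ ⊩ ¬' B ⇒ ¬' A
contrapose p = app (thm ax-Neg)
  (deduction (double-negation-intro (app (weaken p) (double-negation-elim (hyp #0)))))

-- The provable implication.

◇_ : Formula → Formula
◇ A = ¬' □ ¬' A

infix 7 ◇_

E : Var → Var → Formula
E x y = atom 2 0 (x ∷ y ∷ [])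

P Q : Var → Formula
P x = atom 1 0 (x ∷ [])
Q x = atom 1 1 (x ∷ [])

P⊆F[P] F[Q]⊆Q P⊆Q : Formula
P⊆F[P] = ∀' 0 (∀' 1 (E 0 1 ⇒ P 0 ⇒ ◇ P 1))
F[Q]⊆Q = ∀' 0 (∀' 1 (E 0 1 ⇒ ◇ Q 1) ⇒ Q 0)
P⊆Q    = ∀' 0 (P 0 ⇒ Q 0)

-- F is monotone and its diamond looks only at accessible worlds, so `□ P⊆Q` suffices for P ⊆ F(P) ⊆
-- F(Q) ⊆ Q.
F-monotone : □ P⊆Q ∷ P⊆F[P] ∷ F[Q]⊆Q ∷ [] ⊩ P⊆Q
F-monotone = generalize ((λ ()) ∷ (λ ()) ∷ (λ ()) ∷ []) (deduction
  (app (instantiate 0 0 (∀' 1 (E 0 1 ⇒ ◇ Q 1) ⇒ Q 0) (inj₂ ((λ ()) , tt , tt) , tt) (hyp #3))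
    (generalize ((λ { (here ()) ; (there ()) }) ∷ (λ ()) ∷ (λ ()) ∷ (λ ()) ∷ [])
      (deduction (app ◇P⇒◇Q (app (app E⇒P⇒◇P (hyp #0)) (hyp #1)))))))
  where
  □P⊆Q⇒□[¬Q⇒¬P] : □ P⊆Q ∷ [] ⊩ □ (¬' Q 1 ⇒ ¬' P 1)
  □P⊆Q⇒□[¬Q⇒¬P] = necessitate (contrapose (instantiate 0 1 (P 0 ⇒ Q 0) (tt , tt) (hyp #0)))

  E⇒P⇒◇P : E 0 1 ∷ P 0 ∷ □ P⊆Q ∷ P⊆F[P] ∷ Γ ⊩ E 0 1 ⇒ P 0 ⇒ ◇ P 1
  E⇒P⇒◇P = instantiate 1 1 (E 0 1 ⇒ P 0 ⇒ ◇ P 1) (tt , tt , tt)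
    (instantiate 0 0 (∀' 1 (E 0 1 ⇒ P 0 ⇒ ◇ P 1)) (inj₂ ((λ ()) , tt , tt , tt)) (hyp #3))

  ◇P⇒◇Q : E 0 1 ∷ P 0 ∷ □ P⊆Q ∷ Γ ⊩ ◇ P 1 ⇒ ◇ Q 1
  ◇P⇒◇Q = contrapose (app (thm ax-□K) (cut (hyp #2 ∷ []) □P⊆Q⇒□[¬Q⇒¬P]))

hypotheses : List Formula
hypotheses = P⊆F[P] ∷ □ P⊆F[P] ∷ F[Q]⊆Q ∷ □ F[Q]⊆Q ∷ []

-- Necessitating case `n` gives `□ P⊆Q`, and `F-monotone` then gives `P⊆Q`. The boxed hypotheses
-- make the induction go through: `ax-4` supplies their doubly boxed forms.
P⊆Q-at-depth : ∀ n → □^ n ⊥' ∷ hypotheses ⊩ P⊆Q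
P⊆Q-at-depth zero    = ex-falso (hyp #0)
P⊆Q-at-depth (suc n) = cut (□P⊆Q ∷ hyp #1 ∷ hyp #3 ∷ []) F-monotone
  where
  □P⊆Q : □^ (suc n) ⊥' ∷ hypotheses ⊩ □ P⊆Q
  □P⊆Q = cut
    (hyp #0 ∷ hyp #2 ∷ app (thm ax-4) (hyp #2) ∷ hyp #4 ∷ app (thm ax-4) (hyp #4) ∷ [])
    (necessitate (P⊆Q-at-depth n))

-- `ω-rule` applies to theorems only, so the hypotheses are moved into the conclusion and brought
-- back afterwards.
ω-rule⊩ : (∀ n → □^ (suc n) ⊥' ∷ Γ ⊩ A) → Γ ⊩ A
ω-rule⊩ {Γ = []}    p = thm (ω-rule λ n → close (deduction (p n)))
ω-rule⊩ {Γ = B ∷ Γ} p = undischarge (ω-rule⊩ λ n → deduction (cut (exchange n) (p n)))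
  where
  exchange : ∀ n → All (B ∷ □^ (suc n) ⊥' ∷ Γ ⊩_) (□^ (suc n) ⊥' ∷ B ∷ Γ)
  exchange n = hyp #1 ∷ hyp #0 ∷ tabulate (hyp ∘ there ∘ there)

-- Conjunction is not primitive: the negated chain of implications says that `F[Q]⊆Q` and `□ F[Q]⊆Q`
-- hold while `∀' 0 (Q 0)` fails.
antecedent succedent : Formula
antecedent = ¬' (F[Q]⊆Q ⇒ □ F[Q]⊆Q ⇒ ∀' 0 (Q 0))
succedent  = P⊆F[P] ⇒ □ P⊆F[P] ⇒ ¬' ∀' 0 (P 0)

antecedent⇒succedent : NQGL⊢ antecedent ⇒ succedent
antecedent⇒succedent = close (deduction (deduction (deduction
  (app (contrapose (deduction (deduction (deduction ∀Q)))) (hyp #2)))))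
  where
  ∀Q : □ F[Q]⊆Q ∷ F[Q]⊆Q ∷ ∀' 0 (P 0) ∷ □ P⊆F[P] ∷ P⊆F[P] ∷ antecedent ∷ [] ⊩ ∀' 0 (Q 0)
  ∀Q = generalize ((λ ()) ∷ (λ ()) ∷ (λ ()) ∷ (λ ()) ∷ (λ ()) ∷ (λ ()) ∷ [])
    (app (instantiate 0 0 (P 0 ⇒ Q 0) (tt , tt)
           (cut (hyp #4 ∷ hyp #3 ∷ hyp #1 ∷ hyp #0 ∷ [])
                (ω-rule⊩ (λ n → P⊆Q-at-depth (suc n)))))
         (instantiate 0 0 (P 0) tt (hyp #2)))

-- Renaming of variables and Kripke semantics.

¬FreeIn⇒FreeFor : ∀ A → ¬ FreeIn x A → FreeFor y x A
¬FreeIn⇒FreeFor ⊤'            _  = tt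
¬FreeIn⇒FreeFor ⊥'            _  = tt
¬FreeIn⇒FreeFor (atom n i us) _  = tt
¬FreeIn⇒FreeFor (¬' A)        x∉ = ¬FreeIn⇒FreeFor A (x∉ ∘ negᶠ)
¬FreeIn⇒FreeFor (A ⇒ B)       x∉ =
  ¬FreeIn⇒FreeFor A (x∉ ∘ impˡᶠ) , ¬FreeIn⇒FreeFor B (x∉ ∘ impʳᶠ)
¬FreeIn⇒FreeFor (∀' u A)      x∉ = inj₁ x∉
¬FreeIn⇒FreeFor (□ A)         x∉ = ¬FreeIn⇒FreeFor A (x∉ ∘ boxᶠ)

renameVar-≢ : ∀ {z} → z ≢ x → renameVar y x z ≡ z
renameVar-≢ {x = x} {z = z} z≢x with z ≟ x
... | yes z≡x = ⊥-elim (z≢x z≡x)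
... | no  _   = refl

renameVar-avoids : ∀ {z} → u ≢ y → z ≢ u → renameVar y x z ≢ u
renameVar-avoids {x = x} {z = z} u≢y z≢u with z ≟ x
... | yes _ = u≢y ∘ sym
... | no  _ = z≢u

map-cong-∈ : ∀ {S T : Set} {n} {f g : S → T} (us : Vec S n) →
             (∀ z → z Vec∈.∈ us → f z ≡ g z) → Vec.map f us ≡ Vec.map g us
map-cong-∈ []       _ = refl
map-cong-∈ (u ∷ us) h =
  cong₂ _∷_ (h u (VecAny.here refl)) (map-cong-∈ us (λ z → h z ∘ VecAny.there))

-- Constant-domain Kripke models on the chain (ℕ, >).  Atoms are required to be
-- stable so that classical logic is sound for the Tarskian clauses.
module Chain {D : Set} (val : ℕ → (n i : ℕ) → Vec D n → Set)
             (val-stable : ∀ w n i ds → ¬ ¬ val w n i ds → val w n i ds) where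

  infixl 6 _[_↦_]

  _[_↦_] : (Var → D) → Var → D → Var → D
  (ρ [ x ↦ d ]) z with z ≟ x
  ... | yes _ = d
  ... | no  _ = ρ z

  update-≡ : ∀ ρ x d → (ρ [ x ↦ d ]) x ≡ d
  update-≡ ρ x d with x ≟ x
  ... | yes _   = refl
  ... | no  x≢x = ⊥-elim (x≢x refl)

  update-≢ : ∀ ρ x d z → z ≢ x → (ρ [ x ↦ d ]) z ≡ ρ z
  update-≢ ρ x d z z≢x with z ≟ x
  ... | yes z≡x = ⊥-elim (z≢x z≡x)
  ... | no  _   = refl

  ⟦_⟧ : Formula → ℕ → (Var → D) → Set
  ⟦ ⊤' ⟧          w ρ = ⊤
  ⟦ ⊥' ⟧          w ρ = ⊥
  ⟦ atom n i us ⟧ w ρ = val w n i (Vec.map ρ us)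
  ⟦ ¬' A ⟧        w ρ = ¬ ⟦ A ⟧ w ρ
  ⟦ A ⇒ B ⟧       w ρ = ⟦ A ⟧ w ρ → ⟦ B ⟧ w ρ
  ⟦ ∀' u A ⟧      w ρ = ∀ d → ⟦ A ⟧ w (ρ [ u ↦ d ])
  ⟦ □ A ⟧         w ρ = ∀ v → v < w → ⟦ A ⟧ v ρ

  stable : ∀ A {w ρ} → ¬ ¬ ⟦ A ⟧ w ρ → ⟦ A ⟧ w ρ
  stable ⊤'            _   = tt
  stable ⊥'            ¬¬a = ¬¬a id
  stable (atom n i us) ¬¬a = val-stable _ n i _ ¬¬a
  stable (¬' A)        ¬¬a = λ a → ¬¬a λ ¬a → ¬a a
  stable (A ⇒ B)       ¬¬f = λ a → stable B λ ¬b → ¬¬f λ f → ¬b (f a)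
  stable (∀' u A)      ¬¬f = λ d → stable A λ ¬a → ¬¬f λ f → ¬a (f d)
  stable (□ A)         ¬¬f = λ v v<w → stable A λ ¬a → ¬¬f λ f → ¬a (f v v<w)

  update-agree : ∀ {ρ σ : Var → D} {u} d → (∀ z → FreeIn z (∀' u A) → ρ z ≡ σ z) →
                 ∀ z → FreeIn z A → (ρ [ u ↦ d ]) z ≡ (σ [ u ↦ d ]) z
  update-agree {u = u} d h z z∈A with z ≟ u
  ... | yes _   = refl
  ... | no  z≢u = h z (allᶠ z≢u z∈A)

  coincidence : ∀ A {w ρ σ} → (∀ z → FreeIn z A → ρ z ≡ σ z) → ⟦ A ⟧ w ρ → ⟦ A ⟧ w σ
  coincidence ⊤'            h _ = tt
  coincidence (atom n i us) h a = subst (val _ n i) (map-cong-∈ us λ z → h z ∘ atomᶠ) a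
  coincidence (¬' A)        h ¬a = ¬a ∘ coincidence A (λ z → sym ∘ h z ∘ negᶠ)
  coincidence (A ⇒ B)       h f =
    coincidence B (λ z → h z ∘ impʳᶠ) ∘ f ∘ coincidence A (λ z → sym ∘ h z ∘ impˡᶠ)
  coincidence (∀' u A)      h f d = coincidence A (update-agree d h) (f d)
  coincidence (□ A)         h f v v<w = coincidence A (λ z → h z ∘ boxᶠ) (f v v<w)

  -- Two assignments that agree pointwise on free variables, rather than one and its update, let the
  -- induction pass under a quantifier without function extensionality.
  substitution : ∀ A {w ρ σ} → FreeFor y x A →
                 (∀ z → FreeIn z A → ρ (renameVar y x z) ≡ σ z) →
                 ⟦ A [ y / x ] ⟧ w ρ ⇔ ⟦ A ⟧ w σ
  substitution ⊤' _ _ = mk⇔ id id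
  substitution ⊥' _ _ = mk⇔ id id
  substitution {y = y} {x = x} (atom n i us) {w} {ρ} {σ} _ h =
    mk⇔ (subst (val w n i) eq) (subst (val w n i) (sym eq))
    where
    eq : Vec.map ρ (Vec.map (renameVar y x) us) ≡ Vec.map σ us
    eq = trans (sym (map-∘ ρ (renameVar y x) us)) (map-cong-∈ us λ z → h z ∘ atomᶠ)
  substitution (¬' A) ff h = mk⇔ (_∘ from e) (_∘ to e)
    where e = substitution A ff (λ z → h z ∘ negᶠ)
  substitution (A ⇒ B) (ffA , ffB) h =
    mk⇔ (λ f → to eB ∘ f ∘ from eA) (λ f → from eB ∘ f ∘ to eA)
    where
    eA = substitution A ffA (λ z → h z ∘ impˡᶠ)
    eB = substitution B ffB (λ z → h z ∘ impʳᶠ)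
  substitution (□ A) ff h =
    mk⇔ (λ f v v<w → to (e v) (f v v<w)) (λ f v v<w → from (e v) (f v v<w))
    where e = λ v → substitution A {w = v} ff (λ z → h z ∘ boxᶠ)
  substitution {y = y} {x = x} (∀' u A) {ρ = ρ} {σ} ff h with u ≟ x
  ... | yes refl = mk⇔ (coincidence (∀' u A) agree)
                       (coincidence (∀' u A) λ z → sym ∘ agree z)
    where
    agree : ∀ z → FreeIn z (∀' u A) → ρ z ≡ σ z
    agree z z∈@(allᶠ z≢u _) = trans (cong ρ (sym (renameVar-≢ z≢u))) (h z z∈)
  ... | no u≢x = mk⇔ (λ f d → to (e d) (f d)) (λ f d → from (e d) (f d))
    where
    -- If `x` is not free in `∀' u A`, then it is not free in `A` either, because `u ≢ x`.
    ffA : FreeFor y x A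
    ffA = [ (λ x∉ → ¬FreeIn⇒FreeFor A (x∉ ∘ allᶠ (u≢x ∘ sym))) , proj₂ ]′ ff

    avoids : ∀ z → z ≢ u → FreeIn z A → renameVar y x z ≢ u
    avoids z z≢u z∈A =
      [ (λ x∉ → subst (_≢ u) (sym (renameVar-≢ λ { refl → x∉ (allᶠ z≢u z∈A) })) z≢u)
      , (λ (u≢y , _) → renameVar-avoids u≢y z≢u)
      ]′ ff

    agree : ∀ d z → FreeIn z A → (ρ [ u ↦ d ]) (renameVar y x z) ≡ (σ [ u ↦ d ]) z
    agree d z z∈A with z ≟ u
    ... | yes refl = trans (cong (ρ [ u ↦ d ]) (renameVar-≢ u≢x)) (update-≡ ρ u d)
    ... | no  z≢u  = trans (update-≢ ρ u d _ (avoids z z≢u z∈A)) (h z (allᶠ z≢u z∈A))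

    e = λ d → substitution A ffA (agree d)

  update-renameVar : ∀ ρ z → ρ (renameVar y x z) ≡ (ρ [ x ↦ ρ y ]) z
  update-renameVar {x = x} ρ z with z ≟ x
  ... | yes _ = refl
  ... | no  _ = refl

  □^⊥-holds : ∀ n {w ρ} → w < n → ⟦ □^ n ⊥' ⟧ w ρ
  □^⊥-holds (suc n) (s≤s w≤n) v v<w = □^⊥-holds n (<-≤-trans v<w w≤n)

  soundness : NQGL⊢ A → ∀ w ρ → ⟦ A ⟧ w ρ
  soundness ax-K w ρ a _ = a
  soundness ax-S w ρ f g a = f a (g a)
  soundness (ax-Neg {B = B}) w ρ f a = stable B λ ¬b → f ¬b a
  soundness ax-⊤ w ρ = tt
  soundness ax-⊥ w ρ = id
  soundness (ax-∀E {y = y} {A = A} ff) w ρ f =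
    from (substitution A ff (λ z _ → update-renameVar ρ z)) (f (ρ y))
  soundness (ax-∀I {x} {A} x∉A) w ρ f a d = f d (coincidence A agree a)
    where
    agree : ∀ z → FreeIn z A → ρ z ≡ (ρ [ x ↦ d ]) z
    agree z z∈A = sym (update-≢ ρ x d z λ { refl → x∉A z∈A })
  soundness ax-□K w ρ f g v v<w = f v v<w (g v v<w)
  soundness ax-4 w ρ f v v<w v′ v′<v = f v′ (<-trans v′<v v<w)
  soundness (mp p q) w ρ = soundness p w ρ (soundness q w ρ)
  soundness (gen p) w ρ d = soundness p w _
  soundness (nec p) w ρ v _ = soundness p v ρ
  -- No descending chain from `w` has more than `w` steps, so `□^ (suc w) ⊥'` holds at `w` and the
  -- premise number `w` is enough.
  soundness (ω-rule p) w ρ = soundness (p w) w ρ (□^⊥-holds (suc w) ≤-refl)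

-- Modal depth and the countermodel.

modalDepth : Formula → ℕ
modalDepth ⊤'            = 0
modalDepth ⊥'            = 0
modalDepth (atom n i us) = 0
modalDepth (¬' A)        = modalDepth A
modalDepth (A ⇒ B)       = modalDepth A ⊔ modalDepth B
modalDepth (∀' u A)      = modalDepth A
modalDepth (□ A)         = suc (modalDepth A)

module Counterexample (k : ℕ) where

  -- P and Q (indeed all unary symbols) denote {x | x ≤ w} at world w.
  val : ℕ → (n i : ℕ) → Vec (Fin (suc k)) n → Set
  val w 1 _ (a ∷ [])     = toℕ a ≤ w
  val w 2 _ (a ∷ b ∷ []) = toℕ b < toℕ a
  val w _ _ _            = ⊤

  val-stable : ∀ w n i ds → ¬ ¬ val w n i ds → val w n i ds
  val-stable w 0 i ds           _ = tt
  val-stable w 1 i (a ∷ [])     s = decidable-stable (toℕ a ≤? w) s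
  val-stable w 2 i (a ∷ b ∷ []) s = decidable-stable (toℕ b <? toℕ a) s
  val-stable w (suc (suc (suc n))) i ds _ = tt

  open Chain val val-stable public

  val-rigid : ∀ w v n i ds → n ≢ 1 → val w n i ds → val v n i ds
  val-rigid w v 0 i ds           _   _ = tt
  val-rigid w v 1 i ds           n≢1 _ = ⊥-elim (n≢1 refl)
  val-rigid w v 2 i (a ∷ b ∷ []) _   p = p
  val-rigid w v (suc (suc (suc n))) i ds _ _ = tt

  -- Both worlds are arbitrary, so negation and implication may exchange them.
  truth-constant : ∀ A {w v ρ} → (∀ R → Occurs R A → PredSym.arity R ≢ 1) →
                   modalDepth A ≤ w → modalDepth A ≤ v → ⟦ A ⟧ w ρ → ⟦ A ⟧ v ρ
  truth-constant ⊤' _ _ _ _ = tt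
  truth-constant (atom n i us) {w} {v} h _ _ =
    val-rigid w v n i _ (h (psym n i) (atomᵒ refl))
  truth-constant (¬' A) h ≤w ≤v ¬a = ¬a ∘ truth-constant A (λ R → h R ∘ negᵒ) ≤v ≤w
  truth-constant (A ⇒ B) h ≤w ≤v f =
    truth-constant B (λ R → h R ∘ impʳᵒ) (m⊔n≤o⇒n≤o (modalDepth A) _ ≤w)
                                         (m⊔n≤o⇒n≤o (modalDepth A) _ ≤v)
    ∘ f ∘
    truth-constant A (λ R → h R ∘ impˡᵒ) (m⊔n≤o⇒m≤o _ (modalDepth B) ≤v)
                                         (m⊔n≤o⇒m≤o _ (modalDepth B) ≤w)
  truth-constant (∀' u A) h ≤w ≤v f d = truth-constant A (λ R → h R ∘ allᵒ) ≤w ≤v (f d)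
  -- A world `m` up to `modalDepth A` is also below `w`; a higher one agrees on `A` with the world
  -- `modalDepth A`, which lies below `w`.
  truth-constant (□ A) h <w <v f m m<v with ≤-total m (modalDepth A)
  ... | inj₁ m≤d = f m (≤-<-trans m≤d <w)
  ... | inj₂ d≤m = truth-constant A (λ R → h R ∘ boxᵒ) ≤-refl d≤m (f (modalDepth A) <w)

  P⊆F[P]-holds : ∀ w ρ → ⟦ P⊆F[P] ⟧ w ρ
  -- The number `toℕ b` itself serves as the accessible world where `P` holds of `b`.
  P⊆F[P]-holds w ρ a b b<a a≤w □¬Pb = □¬Pb (toℕ b) (<-≤-trans b<a a≤w) ≤-refl

  F[Q]⊆Q-holds : ∀ w ρ → ⟦ F[Q]⊆Q ⟧ w ρ
  F[Q]⊆Q-holds w ρ zero    _ = z≤n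
  -- The premise at the predecessor `inject₁ a` gives a world `v` with `a ≤ v < w`, hence
  -- `suc a ≤ w`.
  F[Q]⊆Q-holds w ρ (suc a) f = decidable-stable (toℕ (suc a) ≤? w) λ a≮w →
    f (inject₁ a) (s≤s (subst (_≤ toℕ a) (sym (toℕ-inject₁ a)) ≤-refl)) λ v v<w a≤v →
    a≮w (≤-<-trans (subst (_≤ v) (toℕ-inject₁ a) a≤v) v<w)

  antecedent-holds : ∀ w ρ → w < k → ⟦ antecedent ⟧ w ρ
  antecedent-holds w ρ w<k f = 1+n≰n (≤-trans w<k
    (subst (_≤ w) (toℕ-fromℕ k)
      -- The greatest element `fromℕ k` is outside `Q` at any world below `k`.
      (f (F[Q]⊆Q-holds w ρ) (λ v _ → F[Q]⊆Q-holds v ρ) (fromℕ k))))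

  succedent-fails : ∀ ρ → ¬ ⟦ succedent ⟧ k ρ
  succedent-fails ρ f =
    f (P⊆F[P]-holds k ρ) (λ v _ → P⊆F[P]-holds v ρ) toℕ≤pred[n]

-- Shared symbols and failure of interpolation.

predSyms : Formula → List PredSym
predSyms ⊤'            = []
predSyms ⊥'            = []
predSyms (atom n i us) = psym n i ∷ []
predSyms (¬' A)        = predSyms A
predSyms (A ⇒ B)       = predSyms A ++ predSyms B
predSyms (∀' u A)      = predSyms A
predSyms (□ A)         = predSyms A

Occurs⇒∈ : ∀ {R} → Occurs R A → R ∈ predSyms A
Occurs⇒∈ (atomᵒ refl)        = here refl
Occurs⇒∈ (negᵒ p)            = Occurs⇒∈ p
Occurs⇒∈ (impˡᵒ p)           = ∈-++⁺ˡ (Occurs⇒∈ p)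
Occurs⇒∈ (impʳᵒ {A = A} p)   = ∈-++⁺ʳ (predSyms A) (Occurs⇒∈ p)
Occurs⇒∈ (allᵒ p)            = Occurs⇒∈ p
Occurs⇒∈ (boxᵒ p)            = Occurs⇒∈ p

unary∈antecedent : All (λ R → PredSym.arity R ≡ 1 → PredSym.index R ≡ 1) (predSyms antecedent)
unary∈antecedent =
  (λ ()) ∷ (λ _ → refl) ∷ (λ _ → refl) ∷ (λ ()) ∷ (λ _ → refl) ∷ (λ _ → refl) ∷ (λ _ → refl) ∷ []

unary∈succedent : All (λ R → PredSym.arity R ≡ 1 → PredSym.index R ≡ 0) (predSyms succedent)
unary∈succedent =
  (λ ()) ∷ (λ _ → refl) ∷ (λ _ → refl) ∷ (λ ()) ∷ (λ _ → refl) ∷ (λ _ → refl) ∷ (λ _ → refl) ∷ []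

-- A shared unary symbol would have index 1, being `Q`, and index 0, being `P`. An interpolant is
-- left with `E`, which is rigid.
no-common-unary : ∀ R → Occurs R antecedent × Occurs R succedent → PredSym.arity R ≢ 1
no-common-unary R (inA , inS) unary
  with trans (sym (lookup unary∈antecedent (Occurs⇒∈ inA) unary))
             (lookup unary∈succedent (Occurs⇒∈ inS) unary)
... | ()

freeVars≡[]⇒Sentence : freeVars A ≡ [] → Sentence A
freeVars≡[]⇒Sentence {A = A} eq x x∈A with () ← subst (x ∈_) eq (FreeIn⇒∈ {A = A} x∈A)

no-interpolant : ∀ C → (∀ R → Occurs R C → Occurs R antecedent × Occurs R succedent) →
                 NQGL⊢ antecedent ⇒ C → ¬ (NQGL⊢ C ⇒ succedent)
no-interpolant C common A⇒C C⇒B = succedent-fails ρ (soundness C⇒B k ρ C-at-k)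
  where
  d = modalDepth C
  -- The least choice with `d < k`: `antecedent` holds at world `d`, `succedent` fails at `k`, and
  -- `C` cannot tell the two worlds apart.
  k = suc d
  open Counterexample k

  ρ : Var → Fin (suc k)
  ρ _ = zero

  C-at-k : ⟦ C ⟧ k ρ
  C-at-k = truth-constant C (λ R R∈C → no-common-unary R (common R R∈C)) ≤-refl (n≤1+n d)
    (soundness A⇒C d ρ (antecedent-holds d ρ ≤-refl))

theorem5p2 : ¬ CraigInterpolation NQGL⊢_
theorem5p2 craig =
  let C , _ , common , A⇒C , C⇒B = craig antecedent succedent
        (freeVars≡[]⇒Sentence {A = antecedent} refl)
        (freeVars≡[]⇒Sentence {A = succedent} refl)
        antecedent⇒succedent
  in no-interpolant C common A⇒C C⇒B
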